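{- Let $G$ be a group and $v:G\to\Gamma\cup\{\infty\}$ a valuation. Assume that for each $\gamma\in\Gamma$ the quotient $G^{\gamma}/G_{\gamma}$ is endowed with a C-quasi-order $\precsim_{\gamma}$. Assume moreover that for any $z\in G$ and any $\gamma\in\Gamma$, the isomorphism $G^{\gamma}/G_{\gamma}\to G^{\gamma^z}/G_{\gamma^z}$ induced by conjugation by $z$ is quasi-order-preserving (with respect to $\precsim_\gamma$ and $\precsim_{\gamma^z}$). Then the lifting of $(\precsim_{\gamma})_{\gamma\in\Gamma}$ to $G$ is also a C-quasi-order.
   Context: A quasi-order is a reflexive, transitive and total binary relation. A C-relation on a set is a ternary relation $C$ such that for all $x,y,z,w$: $C(x,y,z)\Rightarrow C(x,z,y)$; $C(x,y,z)\Rightarrow\neg C(y,x,z)$; $C(x,y,z)\Rightarrow C(w,y,z)\vee C(x,w,z)$; $x\neq y\Rightarrow C(x,y,y)$. On a group it is compatible if $C(x,y,z)$ implies $C(vxu,vyu,vzu)$ for all $x,y,z,u,v$. A C-quasi-order on a group $G$ is a quasi-order of the form $x\precsim y\Leftrightarrow\neg C(x,y,1)$ with $C$ a compatible C-relation on $G$. Write $g^z:=zgz^{ -1}$. A valuation on a group $G$ is a map $v:G\to\Gamma\cup\{\infty\}$, $\Gamma$ totally ordered and $\gamma<\infty$ for all $\gamma\in\Gamma$, such that $v(g)=\infty\Leftrightarrow g=1$; $v(gh^{ -1})\geq\min(v(g),v(h))$; $v(g)\leq v(h)\Leftrightarrow v(g^z)\leq v(h^z)$. It is assumed that every $\gamma\in\Gamma$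 is of the form $v(g)$. Put $G^{\gamma}=\{g\mid v(g)\geq\gamma\}$ and $G_{\gamma}=\{g\mid v(g)>\gamma\}$; $G_\gamma$ is a normal subgroup of $G^\gamma$. For $\gamma=v(g)$ put $\gamma^z:=v(g^z)$ (well-defined); conjugation $g\mapsto g^z$ maps $G^\gamma$ onto $G^{\gamma^z}$ and $G_\gamma$ onto $G_{\gamma^z}$, hence induces an isomorphism $G^{\gamma}/G_{\gamma}\to G^{\gamma^z}/G_{\gamma^z}$. A homomorphism $\phi$ of quasi-ordered groups is quasi-order-preserving if $g\precsim h\Leftrightarrow\phi(g)\precsim\phi(h)$. The lifting of $(\precsim_\gamma)_{\gamma\in\Gamma}$ to $G$ is the quasi-order $g\precsim h\Leftrightarrow v(g)>v(h)\vee(v(g)=v(h)=\gamma\in\Gamma\wedge gG_{\gamma}\precsim_{\gamma}hG_{\gamma})$ (with $1\precsim1$). -}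

module Defs where

open import Level using (Level; suc; _⊔_)
open import Algebra.Bundles using (Group)
import Algebra.Construct.NaturalChoice.Min as Min
open import Algebra.Morphism.Structures using (module GroupMorphisms)
import Algebra.Properties.Group as GroupProperties
open import Data.Empty using (⊥-elim)
open import Data.Product using (Σ; Σ-syntax; ∃-syntax; _×_; _,_; proj₁; proj₂)
open import Data.Sum using (_⊎_; inj₁; inj₂)
open import Function.Bundles using (_⇔_; mk⇔; Equivalence)
open import Relation.Binary.Bundles using (Setoid; TotalOrder)
import Relation.Binary.Construct.Add.Supremum.NonStrict as Supremum≤
import Relation.Binary.Construct.NonStrictToStrict as ToStrict
open import Relation.Binary.Core using (Rel)
open import Relation.Binary.Structures using (IsTotalPreorder)
import Relation.Binary.Reasoning.Setoid as SetoidReasoning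
open import Relation.Nullary using (¬_)
open import Relation.Nullary.Construct.Add.Supremum using ([_]; ⊤⁺)
open import Relation.Unary using (Pred)

private
  variable
    c ℓ a ℓ₁ ℓ₂ r s : Level

module _ (S : Setoid c ℓ) where
  open Setoid S

  record IsCRelation (C : Carrier → Carrier → Carrier → Set r)
                     : Set (c ⊔ ℓ ⊔ r) where
    field
      resp  : ∀ {x x′ y y′ z z′} → x ≈ x′ → y ≈ y′ → z ≈ z′ →
              C x y z → C x′ y′ z′
      swap  : ∀ {x y z} → C x y z → C x z y
      asym  : ∀ {x y z} → C x y z → ¬ C y x z
      split : ∀ {x y z} w → C x y z → C w y z ⊎ C x w z
      C-≉   : ∀ {x y} → ¬ x ≈ y → C x y y

module _ (G : Group c ℓ) where
  open Group G

  record IsCompatibleCRelation (C : Carrier → Carrier → Carrier → Set r)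
                               : Set (c ⊔ ℓ ⊔ r) where
    field
      isCRelation : IsCRelation setoid C
      compatible  : ∀ {x y z} u v → C x y z →
                    C (v ∙ x ∙ u) (v ∙ y ∙ u) (v ∙ z ∙ u)

  -- Taking C at the level of _≾_ loses nothing classically: a C inducing _≾_
  -- is determined by it, as C x y z ⇔ ¬ (x ∙ z ⁻¹ ≾ y ∙ z ⁻¹).
  record IsCQuasiOrder (_≾_ : Rel Carrier r) : Set (c ⊔ ℓ ⊔ suc r) where
    field
      isTotalPreorder       : IsTotalPreorder _≈_ _≾_
      C                     : Carrier → Carrier → Carrier → Set r
      isCompatibleCRelation : IsCompatibleCRelation C
      ≾⇔¬C                  : ∀ x y → x ≾ y ⇔ (¬ C x y ε)

QuasiOrderPreserving : {A : Set a} {B : Set c} → Rel A r → Rel B s →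
                       (A → B) → Set (a ⊔ r ⊔ s)
QuasiOrderPreserving _≾₁_ _≾₂_ φ = ∀ g h → g ≾₁ h ⇔ φ g ≾₂ φ h

conj : (G : Group c ℓ) → let open Group G in Carrier → Carrier → Carrier
conj G z g = z ∙ g ∙ z ⁻¹
  where open Group G

module Extended (Γ : TotalOrder a ℓ₁ ℓ₂) where
  private module Γ = TotalOrder Γ

  Γ∞-totalOrder : TotalOrder a (a ⊔ ℓ₁) (a ⊔ ℓ₂)
  Γ∞-totalOrder = record
    { isTotalOrder = Supremum≤.≤⁺-isTotalOrder Γ._≤_ Γ.isTotalOrder }

  open TotalOrder Γ∞-totalOrder public
    using () renaming (Carrier to Γ∞; _≈_ to _≈∞_; _≤_ to _≤∞_)
  open ToStrict _≈∞_ _≤∞_ public using () renaming (_<_ to _<∞_)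
  open Min Γ∞-totalOrder public using () renaming (_⊓_ to min)

module _ (G : Group c ℓ) (Γ : TotalOrder a ℓ₁ ℓ₂) where
  open Group G
  open Extended Γ

  record Valuation : Set (c ⊔ ℓ ⊔ a ⊔ ℓ₁ ⊔ ℓ₂) where
    field
      v          : Carrier → Γ∞
      v-cong     : ∀ {g h} → g ≈ h → v g ≈∞ v h
      v≈∞⇔≈ε     : ∀ g → v g ≈∞ ⊤⁺ ⇔ g ≈ ε
      v-//       : ∀ g h → min (v g) (v h) ≤∞ v (g ∙ h ⁻¹)
      v-conj     : ∀ g h z → v g ≤∞ v h ⇔ v (conj G z g) ≤∞ v (conj G z h)
      surjective : ∀ γ → ∃[ g ] v g ≈∞ [ γ ]

module ValuedGroup {G : Group c ℓ} {Γ : TotalOrder a ℓ₁ ℓ₂}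
                   (V : Valuation G Γ) where
  open Group G
  open GroupProperties G
  open Extended Γ
  open Valuation V
  open Equivalence using (to; from)
  private
    module Γ = TotalOrder Γ
    module ∞ = TotalOrder Γ∞-totalOrder
    module ∞< = ToStrict _≈∞_ _≤∞_
  open Supremum≤ Γ._≤_ using (_≤⊤⁺)

  G≥ : Γ.Carrier → Pred Carrier (a ⊔ ℓ₂)
  G≥ γ g = [ γ ] ≤∞ v g

  G> : Γ.Carrier → Pred Carrier (a ⊔ ℓ₁ ⊔ ℓ₂)
  G> γ g = [ γ ] <∞ v g

  ≈⇒G≥ : ∀ {γ g} → v g ≈∞ [ γ ] → G≥ γ g
  ≈⇒G≥ p = ∞.reflexive (∞.Eq.sym p)

  ⊤≰[] : ∀ {γ} → ¬ (⊤⁺ ≤∞ [ γ ])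
  ⊤≰[] ()

  vε≈∞ : v ε ≈∞ ⊤⁺
  vε≈∞ = from (v≈∞⇔≈ε ε) refl

  conj-cong : ∀ z {g h} → g ≈ h → conj G z g ≈ conj G z h
  conj-cong z e = ∙-congʳ (∙-congˡ e)

  conj-ε : ∀ z → conj G z ε ≈ ε
  conj-ε z = trans (∙-congʳ (identityʳ z)) (inverseʳ z)

  conj-∙ : ∀ z g h → conj G z (g ∙ h) ≈ conj G z g ∙ conj G z h
  conj-∙ z g h = begin
    z ∙ (g ∙ h) ∙ z ⁻¹                ≈⟨ ∙-congʳ (assoc z g h) ⟨
    z ∙ g ∙ h ∙ z ⁻¹                  ≈⟨ assoc (z ∙ g) h (z ⁻¹) ⟩
    z ∙ g ∙ (h ∙ z ⁻¹)                ≈⟨ ∙-congˡ (\\-leftDividesʳ z (h ∙ z ⁻¹)) ⟨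
    z ∙ g ∙ (z ⁻¹ ∙ (z ∙ (h ∙ z ⁻¹))) ≈⟨ assoc (z ∙ g) (z ⁻¹) _ ⟨
    z ∙ g ∙ z ⁻¹ ∙ (z ∙ (h ∙ z ⁻¹))   ≈⟨ ∙-congˡ (assoc z h (z ⁻¹)) ⟨
    z ∙ g ∙ z ⁻¹ ∙ (z ∙ h ∙ z ⁻¹)     ∎
    where open SetoidReasoning setoid

  conj-⁻¹ : ∀ z g → conj G z (g ⁻¹) ≈ conj G z g ⁻¹
  conj-⁻¹ z g = inverseˡ-unique _ _
    (trans (sym (conj-∙ z (g ⁻¹) g)) (trans (conj-cong z (inverseˡ g)) (conj-ε z)))

  conj-\\ : ∀ z g h → conj G z (g \\ h) ≈ conj G z g \\ conj G z h
  conj-\\ z g h = trans (conj-∙ z (g ⁻¹) h) (∙-congʳ (conj-⁻¹ z g))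

  conj-self : ∀ z → conj G z z ≈ z
  conj-self z = //-rightDividesʳ z z

  conj-inverse : ∀ z h → conj G z (conj G (z ⁻¹) h) ≈ h
  conj-inverse z h = begin
    z ∙ (z ⁻¹ ∙ h ∙ z ⁻¹ ⁻¹) ∙ z ⁻¹   ≈⟨ ∙-congʳ (∙-congˡ (assoc _ _ _)) ⟩
    z ∙ (z ⁻¹ ∙ (h ∙ z ⁻¹ ⁻¹)) ∙ z ⁻¹ ≈⟨ ∙-congʳ (\\-leftDividesˡ z _) ⟩
    h ∙ z ⁻¹ ⁻¹ ∙ z ⁻¹                ≈⟨ //-rightDividesˡ (z ⁻¹) h ⟩
    h                                 ∎
    where open SetoidReasoning setoid

  UpClosed : ∀ {p} → Pred Γ∞ p → Set _
  UpClosed P = ∀ {k l} → k ≤∞ l → P k → P l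

  module Closure {p} {P : Pred Γ∞ p} (up : UpClosed P) where
    resp : ∀ {g h} → g ≈ h → P (v g) → P (v h)
    resp e = up (∞.reflexive (v-cong e))

    ε-closed : ∀ {g} → P (v g) → P (v ε)
    ε-closed {g} = up (∞.trans (v g ≤⊤⁺) (∞.reflexive (∞.Eq.sym vε≈∞)))

    //-closed : ∀ {g h} → P (v g) → P (v h) → P (v (g // h))
    //-closed {g} {h} p q with Min.⊓-sel Γ∞-totalOrder (v g) (v h)
    ... | inj₁ e = up (∞.trans (∞.reflexive (∞.Eq.sym e)) (v-// g h)) p
    ... | inj₂ e = up (∞.trans (∞.reflexive (∞.Eq.sym e)) (v-// g h)) q

    ⁻¹-closed : ∀ {g} → P (v g) → P (v (g ⁻¹))
    ⁻¹-closed p = resp (identityˡ _) (//-closed (ε-closed p) p)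

    ∙-closed : ∀ {g h} → P (v g) → P (v h) → P (v (g ∙ h))
    ∙-closed p q = resp (∙-congˡ (⁻¹-involutive _)) (//-closed p (⁻¹-closed q))

  module Cl≥ (γ : Γ.Carrier) = Closure {P = [ γ ] ≤∞_} (λ k≤l γ≤k → ∞.trans γ≤k k≤l)
  module Cl> (γ : Γ.Carrier) = Closure {P = [ γ ] <∞_}
    (λ k≤l γ<k → ∞<.<-≤-trans ∞.Eq.sym ∞.trans ∞.antisym ∞.≤-respʳ-≈ γ<k k≤l)

  ε∈G≥ : ∀ γ → G≥ γ ε
  ε∈G≥ γ = ∞.trans ([ γ ] ≤⊤⁺) (∞.reflexive (∞.Eq.sym vε≈∞))

  ε∈G> : ∀ γ → G> γ ε
  ε∈G> γ = ε∈G≥ γ , λ e → ⊤≰[] (∞.reflexive (∞.Eq.trans (∞.Eq.sym vε≈∞) (∞.Eq.sym e)))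

  normal : ∀ γ {z g} → G≥ γ z → G> γ g → G> γ (conj G z g)
  normal γ {z} {g} γ≤z γ<g@(γ≤g , γ≉g) with ∞.total (v g) (v z)
  ... | inj₁ g≤z = Cl>.//-closed γ (Cl>.∙-closed γ γ<z γ<g) γ<z
    where γ<z = ∞<.<-≤-trans ∞.Eq.sym ∞.trans ∞.antisym ∞.≤-respʳ-≈ γ<g g≤z
  ... | inj₂ z≤g = ∞.trans γ≤z z≤gᶻ , λ e → γ≉g (∞.antisym γ≤g (g≤γ e))
    where
    z≤gᶻ = ∞.trans (∞.reflexive (v-cong (sym (conj-self z)))) (to (v-conj z g z) z≤g)
    g≤γ : [ γ ] ≈∞ v (conj G z g) → v g ≤∞ [ γ ]
    g≤γ e = ∞.trans (from (v-conj g z z) gᶻ≤zᶻ) (∞.trans z≤gᶻ gᶻ≤γ)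
      where
      gᶻ≤γ = ∞.reflexive (∞.Eq.sym e)
      gᶻ≤zᶻ = ∞.trans gᶻ≤γ (∞.trans γ≤z (∞.reflexive (v-cong (sym (conj-self z)))))

  ≈⇒G>-\\ : ∀ γ {g h} → g ≈ h → G> γ (g \\ h)
  ≈⇒G>-\\ γ e = Cl>.resp γ (sym (trans (\\-cong₂ refl (sym e)) (inverseˡ _))) (ε∈G> γ)

  -- Elements of the quotient G≥ γ / G> γ are represented by elements of G≥ γ,
  -- identified when they lie in the same left coset of G> γ.
  Quotient : Γ.Carrier → Group (c ⊔ a ⊔ ℓ₂) (a ⊔ ℓ₁ ⊔ ℓ₂)
  Quotient γ = record
    { Carrier = Σ Carrier (G≥ γ)
    ; _≈_     = λ (g , _) (h , _) → G> γ (g \\ h)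
    ; _∙_     = λ (g , p) (h , q) → g ∙ h , Cl≥.∙-closed γ p q
    ; ε       = ε , ε∈G≥ γ
    ; _⁻¹     = λ (g , p) → g ⁻¹ , Cl≥.⁻¹-closed γ p
    ; isGroup = record
      { isMonoid = record
        { isSemigroup = record
          { isMagma = record
            { isEquivalence = record
              { refl  = ≈⇒G>-\\ γ refl
              ; sym   = λ p → Cl>.resp γ (⁻¹-anti-homo-\\ _ _) (Cl>.⁻¹-closed γ p)
              ; trans = λ p q → Cl>.resp γ (\\-trans _ _ _) (Cl>.∙-closed γ p q)
              }
            ; ∙-cong = λ {_} {_} {(h , q)} p₁ p₂ → Cl>.resp γ (\\-∙ _ _ _ _)
                (Cl>.∙-closed γ (normal γ (Cl≥.⁻¹-closed γ q) p₁) p₂)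
            }
          ; assoc = λ _ _ _ → ≈⇒G>-\\ γ (assoc _ _ _)
          }
        ; identity = (λ _ → ≈⇒G>-\\ γ (identityˡ _)) , (λ _ → ≈⇒G>-\\ γ (identityʳ _))
        }
      ; inverse = (λ _ → ≈⇒G>-\\ γ (inverseˡ _)) , (λ _ → ≈⇒G>-\\ γ (inverseʳ _))
      ; ⁻¹-cong = λ {(g , p)} {(h , q)} g~h → Cl>.resp γ (conj-\\-⁻¹ g h)
          (normal γ p (Cl>.resp γ (⁻¹-anti-homo-\\ g h) (Cl>.⁻¹-closed γ g~h)))
      }
    }
    where
    open SetoidReasoning setoid

    \\-trans : ∀ g h k → (g \\ h) ∙ (h \\ k) ≈ g \\ k
    \\-trans g h k = trans (assoc _ _ _) (∙-congˡ (\\-leftDividesˡ h k))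

    \\-∙ : ∀ g g′ h h′ → conj G (h ⁻¹) (g \\ g′) ∙ (h \\ h′) ≈ (g ∙ h) \\ (g′ ∙ h′)
    \\-∙ g g′ h h′ = begin
      h ⁻¹ ∙ (g \\ g′) ∙ h ⁻¹ ⁻¹ ∙ (h ⁻¹ ∙ h′) ≈⟨ assoc _ _ _ ⟩
      h ⁻¹ ∙ (g \\ g′) ∙ (h ⁻¹ \\ (h ⁻¹ ∙ h′)) ≈⟨ ∙-congˡ (\\-leftDividesʳ (h ⁻¹) h′) ⟩
      h ⁻¹ ∙ (g ⁻¹ ∙ g′) ∙ h′                  ≈⟨ ∙-congʳ (assoc _ _ _) ⟨
      h ⁻¹ ∙ g ⁻¹ ∙ g′ ∙ h′                    ≈⟨ assoc _ _ _ ⟩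
      h ⁻¹ ∙ g ⁻¹ ∙ (g′ ∙ h′)                  ≈⟨ ∙-congʳ (⁻¹-anti-homo-∙ g h) ⟨
      (g ∙ h) ⁻¹ ∙ (g′ ∙ h′)                   ∎

    conj-\\-⁻¹ : ∀ g h → conj G g (h \\ g) ≈ (g ⁻¹) \\ (h ⁻¹)
    conj-\\-⁻¹ g h = begin
      g ∙ (h ⁻¹ ∙ g) ∙ g ⁻¹ ≈⟨ ∙-congʳ (assoc _ _ _) ⟨
      g ∙ h ⁻¹ ∙ g ∙ g ⁻¹   ≈⟨ //-rightDividesʳ g (g ∙ h ⁻¹) ⟩
      g ∙ h ⁻¹              ≈⟨ ∙-congʳ (⁻¹-involutive g) ⟨
      g ⁻¹ ⁻¹ ∙ h ⁻¹        ∎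

  v-conj-cong : ∀ {g h} z → v g ≈∞ v h → v (conj G z g) ≈∞ v (conj G z h)
  v-conj-cong z e = ∞.antisym (to (v-conj _ _ z) (∞.reflexive e))
                              (to (v-conj _ _ z) (∞.reflexive (∞.Eq.sym e)))

  v-conj-cong⁻ : ∀ {g h} z → v (conj G z g) ≈∞ v (conj G z h) → v g ≈∞ v h
  v-conj-cong⁻ z e = ∞.antisym (from (v-conj _ _ z) (∞.reflexive e))
                               (from (v-conj _ _ z) (∞.reflexive (∞.Eq.sym e)))

  finite : ∀ k → ¬ k ≈∞ ⊤⁺ → ∃[ δ ] k ≈∞ [ δ ]
  finite [ δ ] _ = δ , ∞.Eq.refl
  finite ⊤⁺    n = ⊥-elim (n ∞.Eq.refl)

  conj-finite : ∀ γ z → ∃[ δ ] v (conj G z (proj₁ (surjective γ))) ≈∞ [ δ ]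
  conj-finite γ z = finite _ λ vgᶻ≈∞ →
    let vgᶻ≈vεᶻ = ∞.Eq.trans vgᶻ≈∞
                    (∞.Eq.sym (∞.Eq.trans (v-cong (conj-ε z)) vε≈∞))
        vg≈∞    = ∞.Eq.trans (v-conj-cong⁻ z vgᶻ≈vεᶻ) vε≈∞
    in ⊤≰[] (∞.reflexive (∞.Eq.trans (∞.Eq.sym vg≈∞) (proj₂ (surjective γ))))

  infixl 8 _^_

  _^_ : Γ.Carrier → Carrier → Γ.Carrier
  γ ^ z = proj₁ (conj-finite γ z)

  -- The characterisation γ ^ z = v (conj z g) for every g with v g = γ, i.e.
  -- independence of the preimage of γ used to define γ ^ z.
  ^-spec : ∀ {γ g} z → v g ≈∞ [ γ ] → v (conj G z g) ≈∞ [ γ ^ z ]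
  ^-spec {γ} z e = ∞.Eq.trans
    (v-conj-cong z (∞.Eq.trans e (∞.Eq.sym (proj₂ (surjective γ)))))
    (proj₂ (conj-finite γ z))

  G≥-conj : ∀ γ z {g} → G≥ γ g ⇔ G≥ (γ ^ z) (conj G z g)
  G≥-conj γ z {g} = mk⇔
    (λ p → ∞.≤-respˡ-≈ eᶻ (to (v-conj g₀ g z) (∞.≤-respˡ-≈ (∞.Eq.sym e) p)))
    (λ p → ∞.≤-respˡ-≈ e (from (v-conj g₀ g z) (∞.≤-respˡ-≈ (∞.Eq.sym eᶻ) p)))
    where
    g₀ = proj₁ (surjective γ)
    e  = proj₂ (surjective γ)
    eᶻ = ^-spec z e

  G>-conj : ∀ γ z {g} → G> γ g ⇔ G> (γ ^ z) (conj G z g)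
  G>-conj γ z {g} = mk⇔
    (λ (p , p≉) → to (G≥-conj γ z) p ,
       λ q → p≉ (∞.Eq.trans (∞.Eq.sym e) (v-conj-cong⁻ z (∞.Eq.trans eᶻ q))))
    (λ (p , p≉) → from (G≥-conj γ z) p ,
       λ q → p≉ (∞.Eq.trans (∞.Eq.sym eᶻ) (v-conj-cong z (∞.Eq.trans e q))))
    where
    e  = proj₂ (surjective γ)
    eᶻ = ^-spec z e

  quotientConj : ∀ γ z → Group.Carrier (Quotient γ) → Group.Carrier (Quotient (γ ^ z))
  quotientConj γ z (g , p) = conj G z g , to (G≥-conj γ z) p

  quotientConj-isGroupIsomorphism : ∀ γ z →
    GroupMorphisms.IsGroupIsomorphism
      (Group.rawGroup (Quotient γ)) (Group.rawGroup (Quotient (γ ^ z))) (quotientConj γ z)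
  quotientConj-isGroupIsomorphism γ z = record
    { isGroupMonomorphism = record
      { isGroupHomomorphism = record
        { isMonoidHomomorphism = record
          { isMagmaHomomorphism = record
            { isRelHomomorphism = record { cong = ~-cong }
            ; homo              = λ _ _ → ≈⇒G>-\\ (γ ^ z) (conj-∙ z _ _)
            }
          ; ε-homo = ≈⇒G>-\\ (γ ^ z) (conj-ε z)
          }
        ; ⁻¹-homo = λ _ → ≈⇒G>-\\ (γ ^ z) (conj-⁻¹ z _)
        }
      ; injective = λ p → from (G>-conj γ z) (Cl>.resp (γ ^ z) (sym (conj-\\ z _ _)) p)
      }
    ; surjective = λ (h , q) →
        let y : Group.Carrier (Quotient γ)
            y = conj G (z ⁻¹) h
                , from (G≥-conj γ z) (Cl≥.resp (γ ^ z) (sym (conj-inverse z h)) q)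
        in y , λ {x} x~y →
             Q′.trans {quotientConj γ z x} {quotientConj γ z y} {h , q}
               (~-cong x~y) (≈⇒G>-\\ (γ ^ z) (conj-inverse z h))
    }
    where
    module Q′ = Group (Quotient (γ ^ z))
    ~-cong : ∀ {g h} → G> γ (g \\ h) → G> (γ ^ z) (conj G z g \\ conj G z h)
    ~-cong p = Cl>.resp (γ ^ z) (conj-\\ z _ _) (to (G>-conj γ z) p)

  QuotientRelations : ∀ r → Set (c ⊔ a ⊔ ℓ₂ ⊔ suc r)
  QuotientRelations r = ∀ γ → Rel (Group.Carrier (Quotient γ)) r

  -- Γ is a setoid, so a family indexed by it must not distinguish equal indices.
  -- This holds by substitution when the equality of Γ is propositional and the
  -- relations respect the equality of the quotients.
  RespectsIndex : QuotientRelations r → Set (c ⊔ a ⊔ ℓ₁ ⊔ ℓ₂ ⊔ r)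
  RespectsIndex R = ∀ {γ δ g h} → γ Γ.≈ δ →
    (p : G≥ γ g) (q : G≥ γ h) (p′ : G≥ δ g) (q′ : G≥ δ h) →
    R γ (g , p) (h , q) → R δ (g , p′) (h , q′)

  -- The last summand makes ε related to itself, as v ε = ∞ is not in Γ.
  Lifting : QuotientRelations r → Rel Carrier (ℓ ⊔ a ⊔ ℓ₁ ⊔ ℓ₂ ⊔ r)
  Lifting R g h =
      v h <∞ v g
    ⊎ (∃[ γ ] Σ[ p ∈ v g ≈∞ [ γ ] ] Σ[ q ∈ v h ≈∞ [ γ ] ]
        R γ (g , ≈⇒G≥ p) (h , ≈⇒G≥ q))
    ⊎ (g ≈ ε × h ≈ ε)

{-# OPTIONS --safe #-}

-- The C-relation of a C-quasi-order is C(x,y,z) ⇔ ¬ (x z⁻¹ ≾ y z⁻¹), so a total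
-- preorder ≾ is a C-quasi-order as soon as 1 is its strict minimum, conjugation
-- reflects ≾, and x y⁻¹ ≾ y⁻¹ implies x ≾ y (the symmetry of C in its last two
-- arguments). The lifting inherits these properties from the quotients because
-- g ≾ h means that v(h) ≤ v(g) and that g G_γ ≾_γ h G_γ for every γ ≤ v(h) in Γ:
-- an element g with v(g) > γ becomes trivial modulo G_γ, hence minimal.
module Submission where

open import Defs
open import Algebra.Bundles using (Group)
import Algebra.Properties.Group as GroupProperties
open import Axiom.ExcludedMiddle using (ExcludedMiddle)
open import Data.Empty using (⊥-elim)
open import Data.Product using (_,_)
open import Data.Sum using (_⊎_; inj₁; inj₂)
import Data.Sum as Sum
open import Function.Base using (_∘_)
open import Function.Bundles using (mk⇔; Equivalence)
open import Level using (Level)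
open import Relation.Binary.Bundles using (TotalOrder)
import Relation.Binary.Construct.Add.Supremum.NonStrict as Supremum≤
open import Relation.Binary.Core using (Rel)
import Relation.Binary.Reasoning.Setoid as SetoidReasoning
open import Relation.Binary.Structures using (IsTotalPreorder)
open import Relation.Nullary using (¬_; yes; no)
open import Relation.Nullary.Construct.Add.Supremum using ([_]; ⊤⁺)
open import Relation.Nullary.Decidable using (decidable-stable)
open Equivalence using (to; from)

private
  variable
    c ℓ a ℓ₁ ℓ₂ r : Level

-- Group identities and a criterion for C-quasi-orders.

module _ (G : Group c ℓ) where
  open Group G
  open GroupProperties G
  open SetoidReasoning setoid

  ∙-cancelʳ-// : ∀ x y u → (x ∙ u) // (y ∙ u) ≈ x // y
  ∙-cancelʳ-// x y u = begin
    x ∙ u ∙ (y ∙ u) ⁻¹      ≈⟨ ∙-congˡ (⁻¹-anti-homo-∙ y u) ⟩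
    x ∙ u ∙ (u ⁻¹ ∙ y ⁻¹)   ≈⟨ assoc _ _ _ ⟩
    x ∙ (u ∙ (u ⁻¹ ∙ y ⁻¹)) ≈⟨ ∙-congˡ (\\-leftDividesˡ u (y ⁻¹)) ⟩
    x ∙ y ⁻¹                ∎

  ∙-//-conj : ∀ v x y → (v ∙ x) // (v ∙ y) ≈ conj G v (x // y)
  ∙-//-conj v x y = begin
    v ∙ x ∙ (v ∙ y) ⁻¹      ≈⟨ ∙-congˡ (⁻¹-anti-homo-∙ v y) ⟩
    v ∙ x ∙ (y ⁻¹ ∙ v ⁻¹)   ≈⟨ assoc _ _ _ ⟨
    v ∙ x ∙ y ⁻¹ ∙ v ⁻¹     ≈⟨ ∙-congʳ (assoc _ _ _) ⟩
    v ∙ (x ∙ y ⁻¹) ∙ v ⁻¹   ∎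

  -- Right translation cancels and left translation conjugates, so compatibility of the C-relation
  -- reduces to reflection of the order under conjugation.
  translate-// : ∀ u v x y → (v ∙ x ∙ u) // (v ∙ y ∙ u) ≈ conj G v (x // y)
  translate-// u v x y = trans (∙-cancelʳ-// (v ∙ x) (v ∙ y) u) (∙-//-conj v x y)

  x//ε≈x : ∀ x → x // ε ≈ x
  x//ε≈x x = trans (∙-congˡ ε⁻¹≈ε) (identityʳ x)

  module _ {_≾_ : Rel Carrier r} where

    module CQuasiOrderProperties (Q : IsCQuasiOrder G _≾_) where
      open IsCQuasiOrder Q
      open IsTotalPreorder isTotalPreorder public
        using (total) renaming (reflexive to ≾-reflexive; trans to ≾-trans)
      open IsCompatibleCRelation isCompatibleCRelation
      open IsCRelation isCRelation

      -- After `swap` the first two arguments of the triple coincide, so asymmetry refutes it by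
      -- itself.
      ε-minimum : ∀ x → ε ≾ x
      ε-minimum x = from (≾⇔¬C ε x) λ p → asym (swap p) (swap p)

      //-cancel-≾ : ∀ x y → (x // y) ≾ (y ⁻¹) → x ≾ y
      -- Right translation by `y ⁻¹` carries the swapped triple (x, 1, y) to (x y⁻¹, y⁻¹, 1).
      //-cancel-≾ x y p = from (≾⇔¬C x y) λ q →
        to (≾⇔¬C (x // y) (y ⁻¹)) p
          (resp (∙-congʳ (identityˡ x))
                (trans (∙-congʳ (identityˡ ε)) (identityˡ (y ⁻¹)))
                (trans (∙-congʳ (identityˡ y)) (inverseʳ y))
                (compatible (y ⁻¹) ε (swap q)))

    isCQuasiOrder :
      ExcludedMiddle r →
      IsTotalPreorder _≈_ _≾_ →
      (∀ {x} → x ≾ ε → x ≈ ε) →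
      (∀ z {x y} → conj G z x ≾ conj G z y → x ≾ y) →
      (∀ {x y} → (x // y) ≾ (y ⁻¹) → x ≾ y) →
      IsCQuasiOrder G _≾_
    isCQuasiOrder em isTotalPreorder ≾ε⇒≈ε conj-reflects //-cancel = record
      { isTotalPreorder = isTotalPreorder
      ; C = λ x y z → ¬ ((x // z) ≾ (y // z))
      ; isCompatibleCRelation = record
        { isCRelation = record
          { resp  = λ x≈x′ y≈y′ z≈z′ p → p ∘ ≾-resp
              (//-cong₂ (sym x≈x′) (sym z≈z′)) (//-cong₂ (sym y≈y′) (sym z≈z′))
          -- Cancellation is applied to `x // z` and `y // z`: their quotient is `x // y`, and the
          -- inverse of the second is `z // y`.
          ; swap  = λ {x} {y} {z} p q → p (//-cancel (≾-resp
              (sym (∙-cancelʳ-// x y (z ⁻¹))) (sym (⁻¹-anti-homo-// y z)) q))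
          ; asym  = λ p q → Sum.[ p , q ] (T.total _ _)
          ; split = split
          ; C-≉   = λ {x} {y} x≉y p → x≉y (x∙y⁻¹≈ε⇒x≈y x y
              (≾ε⇒≈ε (≾-resp refl (inverseʳ y) p)))
          }
        ; compatible = λ {x} {y} {z} u v p q → p (conj-reflects v (≾-resp
            (translate-// u v x z) (translate-// u v y z) q))
        }
      ; ≾⇔¬C = λ x y → mk⇔
          (λ p q → q (≾-resp (sym (x//ε≈x x)) (sym (x//ε≈x y)) p))
          (λ p → ≾-resp (x//ε≈x x) (x//ε≈x y) (decidable-stable em p))
      }
      where
      module T = IsTotalPreorder isTotalPreorder

      ≾-resp : ∀ {x x′ y y′} → x ≈ x′ → y ≈ y′ → x ≾ y → x′ ≾ y′
      ≾-resp x≈x′ y≈y′ p = T.trans (T.reflexive (sym x≈x′)) (T.trans p (T.reflexive y≈y′))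

      split : ∀ {x y z} w → ¬ ((x // z) ≾ (y // z)) →
              ¬ ((w // z) ≾ (y // z)) ⊎ ¬ ((x // z) ≾ (w // z))
      split {x} {y} {z} w p with em {(x // z) ≾ (w // z)}
      ... | yes q = inj₁ (p ∘ T.trans q)
      ... | no ¬q = inj₂ ¬q

-- The lifting along a valuation.

module LiftingProperties
  (em : ∀ {e} → ExcludedMiddle e) {G : Group c ℓ} {Γ : TotalOrder a ℓ₁ ℓ₂}
  (V : Valuation G Γ) (≾ : ValuedGroup.QuotientRelations V r)
  (respectsIndex : ValuedGroup.RespectsIndex V ≾)
  (≾-isCQuasiOrder : ∀ γ → IsCQuasiOrder (ValuedGroup.Quotient V γ) (≾ γ)) where

  open Group G
  open GroupProperties G
  open Extended Γ
  open Valuation V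
  open ValuedGroup V
  private
    module Γ = TotalOrder Γ
    module ∞ = TotalOrder Γ∞-totalOrder
    module Q γ = CQuasiOrderProperties (Quotient γ) (≾-isCQuasiOrder γ)
  open Supremum≤ Γ._≤_ using (_≤⊤⁺; [≤]-injective)

  infix 4 _≼_
  _≼_ = Lifting ≾

  ≼⇒≥ : ∀ {g h} → g ≼ h → v h ≤∞ v g
  ≼⇒≥ (inj₁ (vh≤vg , _))              = vh≤vg
  ≼⇒≥ (inj₂ (inj₁ (_ , p , q , _)))   = ∞.reflexive (∞.Eq.trans q (∞.Eq.sym p))
  ≼⇒≥ (inj₂ (inj₂ (g≈ε , h≈ε)))       = ∞.reflexive (v-cong (trans h≈ε (sym g≈ε)))

  G>⇒~ε : ∀ {γ g} → G> γ g → G> γ (g \\ ε)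
  G>⇒~ε {γ} γ<g = Cl>.resp γ (sym (identityʳ _)) (Cl>.⁻¹-closed γ γ<g)

  G>⇒≾ : ∀ {γ g h} (p : G≥ γ g) (q : G≥ γ h) → G> γ g → ≾ γ (g , p) (h , q)
  G>⇒≾ {γ} p q γ<g =
    Q.≾-trans γ (Q.≾-reflexive γ (G>⇒~ε γ<g)) (Q.ε-minimum γ (_ , q))

  -- With `≼⇒≥` and the converse `≾⇒≼`, this trades the case distinction in `Lifting` for a
  -- condition at each level γ, so that properties of the quotients transfer levelwise.
  ≼⇒≾ : ∀ {γ g h} (p : G≥ γ g) (q : G≥ γ h) → g ≼ h → ≾ γ (g , p) (h , q)
  ≼⇒≾ {γ} {g} {h} p q g≼h with em {_} {[ γ ] ≈∞ v g}
  ... | no γ≉g  = G>⇒≾ p q (p , γ≉g)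
  ... | yes γ≈g with g≼h
  ...   | inj₁ (h≤g , h≉g) =
    ⊥-elim (h≉g (∞.antisym h≤g (∞.trans (∞.reflexive (∞.Eq.sym γ≈g)) q)))
  -- Both δ and γ are the value of g, but they agree only up to the equality of Γ, so the comparison
  -- is transported.
  ...   | inj₂ (inj₁ (δ , p′ , q′ , g≾h)) =
    respectsIndex (Γ.antisym
      ([≤]-injective (∞.reflexive (∞.Eq.sym γ≈δ))) ([≤]-injective (∞.reflexive γ≈δ)))
      (≈⇒G≥ p′) (≈⇒G≥ q′) p q g≾h
    where γ≈δ = ∞.Eq.trans γ≈g p′
  ...   | inj₂ (inj₂ (g≈ε , h≈ε)) =
    Q.≾-reflexive γ (≈⇒G>-\\ γ (trans g≈ε (sym h≈ε)))

  ≾⇒≼ : ∀ {g h} → v h ≤∞ v g →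
        (∀ γ (p : G≥ γ g) (q : G≥ γ h) → ≾ γ (g , p) (h , q)) → g ≼ h
  ≾⇒≼ {g} {h} h≤g g≾h with em {_} {v h ≈∞ v g}
  ... | no h≉g  = inj₁ (h≤g , h≉g)
  ... | yes h≈g with em {_} {v h ≈∞ ⊤⁺}
  ...   | yes h≈∞ =
    inj₂ (inj₂ (to (v≈∞⇔≈ε g) (∞.Eq.trans (∞.Eq.sym h≈g) h≈∞) , to (v≈∞⇔≈ε h) h≈∞))
  ...   | no h≉∞ with finite (v h) h≉∞
  ...     | γ , h≈γ = inj₂ (inj₁ (γ , ∞.Eq.trans (∞.Eq.sym h≈g) h≈γ , h≈γ , g≾h γ _ _))

  ≼-reflexive : ∀ {g h} → g ≈ h → g ≼ h
  ≼-reflexive g≈h = ≾⇒≼ (∞.reflexive (v-cong (sym g≈h)))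
    λ γ _ _ → Q.≾-reflexive γ (≈⇒G>-\\ γ g≈h)

  ≼-trans : ∀ {f g h} → f ≼ g → g ≼ h → f ≼ h
  ≼-trans {f} {g} {h} f≼g g≼h = ≾⇒≼ (∞.trans (≼⇒≥ g≼h) (≼⇒≥ f≼g)) λ γ p q →
    -- The middle element also represents a class at level γ, since γ ≤ v(h) ≤ v(g).
    let γ≤g = ∞.trans q (≼⇒≥ g≼h)
    in Q.≾-trans γ (≼⇒≾ p γ≤g f≼g) (≼⇒≾ γ≤g q g≼h)

  -- Totality of the quotients could choose different directions at different levels, so it is
  -- invoked only at the common value of g and h.
  ≼-total-≥ : ∀ {g h} → v h ≤∞ v g → g ≼ h ⊎ h ≼ g
  ≼-total-≥ {g} {h} h≤g with em {_} {v h ≈∞ v g}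
  ... | no h≉g  = inj₁ (inj₁ (h≤g , h≉g))
  ... | yes h≈g with em {_} {v h ≈∞ ⊤⁺}
  ...   | yes h≈∞ = inj₁ (≼-reflexive (trans
    (to (v≈∞⇔≈ε g) (∞.Eq.trans (∞.Eq.sym h≈g) h≈∞)) (sym (to (v≈∞⇔≈ε h) h≈∞))))
  ...   | no h≉∞ with finite (v h) h≉∞
  ...     | γ , h≈γ = Sum.map
    (λ g≾h → inj₂ (inj₁ (γ , g≈γ , h≈γ , g≾h)))
    (λ h≾g → inj₂ (inj₁ (γ , h≈γ , g≈γ , h≾g)))
    (Q.total γ (g , ≈⇒G≥ g≈γ) (h , ≈⇒G≥ h≈γ))
    where g≈γ = ∞.Eq.trans (∞.Eq.sym h≈g) h≈γ

  ≼-total : ∀ g h → g ≼ h ⊎ h ≼ g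
  ≼-total g h with ∞.total (v h) (v g)
  ... | inj₁ h≤g = ≼-total-≥ h≤g
  ... | inj₂ g≤h = Sum.swap (≼-total-≥ g≤h)

  ≼-isTotalPreorder : IsTotalPreorder _≈_ _≼_
  ≼-isTotalPreorder = record
    { isPreorder = record
      { isEquivalence = isEquivalence
      ; reflexive     = ≼-reflexive
      ; trans         = ≼-trans
      }
    ; total = ≼-total
    }

  ≼ε⇒≈ε : ∀ {g} → g ≼ ε → g ≈ ε
  ≼ε⇒≈ε {g} g≼ε = to (v≈∞⇔≈ε g)
    (∞.antisym (v g ≤⊤⁺) (∞.trans (∞.reflexive (∞.Eq.sym vε≈∞)) (≼⇒≥ g≼ε)))

  //-cancel-≼ : ∀ {g h} → (g // h) ≼ (h ⁻¹) → g ≼ h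
  //-cancel-≼ {g} {h} p = ≾⇒≼ h≤g λ γ γ≤g γ≤h →
    Q.//-cancel-≾ γ (g , γ≤g) (h , γ≤h) (≼⇒≾ _ _ p)
    where
    -- The bound v(h) may be ∞, hence `Closure` rather than `Cl≥`. From v(h⁻¹) ≥ v(h) follows v(g
    -- h⁻¹) ≥ v(h), and then g = (g h⁻¹) h gives v(g) ≥ v(h).
    module Cl≥h = Closure {P = v h ≤∞_} (λ k≤l h≤k → ∞.trans h≤k k≤l)
    h≤g//h : v h ≤∞ v (g // h)
    h≤g//h = ∞.trans (Cl≥h.⁻¹-closed ∞.refl) (≼⇒≥ p)
    h≤g : v h ≤∞ v g
    h≤g = Cl≥h.resp (//-rightDividesˡ h g) (Cl≥h.∙-closed h≤g//h ∞.refl)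

  conj-reflects-≼ :
    (∀ z γ → QuasiOrderPreserving (≾ γ) (≾ (γ ^ z)) (quotientConj γ z)) →
    ∀ z {g h} → conj G z g ≼ conj G z h → g ≼ h
  conj-reflects-≼ conj-preserves z {g} {h} p =
    ≾⇒≼ (from (v-conj h g z) (≼⇒≥ p)) λ γ γ≤g γ≤h →
      -- The conjugates are compared at level `γ ^ z`, and the result is pulled back to level γ.
      from (conj-preserves z γ (g , γ≤g) (h , γ≤h)) (≼⇒≾ _ _ p)

proposition3p36 : (em : ∀ {e} → ExcludedMiddle e) →
    ∀ {c ℓ a ℓ₁ ℓ₂ r} (G : Group c ℓ) (Γ : TotalOrder a ℓ₁ ℓ₂) (V : Valuation G Γ) →
    let open ValuedGroup V in
    (≾ : QuotientRelations r) →
    RespectsIndex ≾ →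
    (∀ γ → IsCQuasiOrder (Quotient γ) (≾ γ)) →
    (∀ z γ → QuasiOrderPreserving (≾ γ) (≾ (γ ^ z)) (quotientConj γ z)) →
    IsCQuasiOrder G (Lifting ≾)
proposition3p36 em G Γ V ≾ respectsIndex ≾-isCQuasiOrder conj-preserves =
  isCQuasiOrder G em ≼-isTotalPreorder ≼ε⇒≈ε (conj-reflects-≼ conj-preserves) //-cancel-≼
  where open LiftingProperties em V ≾ respectsIndex ≾-isCQuasiOrder
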